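{- Let $G$ be a finite simple connected graph with edges $e_1,\dots,e_m$ and let $x\in P(G)$ be such that $\tau(x)\ne0$. Then $x$ is a critical point of the weighted tree number $\tau$ on $P(G)$ if and only if the effective resistances of all the edges of $G(x)$ are the same.
   Context: The weighted edge polytope is $P(G)=\{(x_1,\dots,x_m): x_j\ge 0,\ \sum_{j=1}^m x_j=m\}$; $G(x)$ is $G$ with weight $x_j$ on $e_j$. The weighted tree number is $\tau(x)=\sum_{T}\prod_{e_j\in T}x_j$, the sum being over all spanning trees $T$ of $G$ (equivalently, any cofactor of the weighted Laplacian matrix). Put $\tau_j=\partial\tau/\partial x_j$, the polynomial $\tau$ being regarded as a function of $m$ independent variables. The effective resistance of $e_j$ in $G(x)$ is $\tau_j(x)/\tau(x)$. A point $x\in P(G)$ is critical for $\tau$ if the directional derivative of $\tau$ at $x$ vanishes in every direction $y\in\mathbf{R}^m$ with $\sum_j y_j=0$ (the Lagrange condition for the constraint $\sum_j x_j=m$). -}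

module Defs where

open import Level using (_⊔_) renaming (suc to lsuc)
open import Algebra.Apartness.Bundles using (HeytingField; HeytingCommutativeRing)
open import Algebra.Bundles using (CommutativeRing)
import Algebra.Definitions.RawMonoid as RawMonoidDefs
open import Data.Bool.Base using (if_then_else_)
open import Data.Fin.Base using (Fin; zero; suc; toℕ; fromℕ; fromℕ<; inject₁; finToFun; funToFin)
  renaming (_<_ to _<ᶠ_)
open import Data.Fin.Properties using (_≟_; any?; all?; injective⇒≤; toℕ-fromℕ<; finToFun-funToFin)
open import Data.Fin.Subset using (Subset; inside; outside; _∈_; ⊤)
open import Data.Fin.Subset.Properties using (_∈?_)
open import Data.List.Base using (List; []; _∷_; _++_; map; filter; foldr)
open import Data.Nat.Base as ℕ using (ℕ; zero; suc; NonZero)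
import Data.Nat.Properties as ℕₚ
open import Data.Product.Base using (∃; ∃₂; ∃-syntax; _×_; _,_; proj₁; proj₂)
open import Data.Product.Properties using (≡-dec)
open import Data.Sum.Base using (_⊎_)
open import Data.Vec.Base using ([]; _∷_; lookup)
open import Data.Vec.Functional using (Vector)
open import Function.Base using (_∘_)
open import Function.Bundles using (_⇔_)
open import Function.Definitions using (Injective)
open import Relation.Binary.Core using (Rel)
open import Relation.Binary.Structures using (IsStrictPartialOrder)
open import Relation.Binary.PropositionalEquality
  using (_≡_; _≗_; refl; sym; trans; cong; subst; subst₂)
open import Relation.Nullary using (¬_; Dec; does)
open import Relation.Nullary.Decidable using (map′; _×-dec_; _⊎-dec_; _→-dec_; ¬?)
open import Relation.Unary using (Pred; Decidable)

------------------------------------------------------------------------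
-- Graphs

-- An edge {u , v} is represented by the pair (u , v) with u < v, so
-- loops are excluded, and injectivity excludes multiple edges.
record Graph (n m : ℕ) : Set where
  field
    endpoints  : Fin m → Fin n × Fin n
    ordered    : ∀ j → proj₁ (endpoints j) <ᶠ proj₂ (endpoints j)
    no-repeats : Injective _≡_ _≡_ endpoints

module _ {n m : ℕ} (G : Graph n m) where
  open Graph G

  -- A set T of edges stands for the spanning subgraph (Fin n , T).

  Adjacent : Subset m → Fin n → Fin n → Set
  Adjacent T u v = ∃[ j ] j ∈ T × (endpoints j ≡ (u , v) ⊎ endpoints j ≡ (v , u))

  IsPath : Subset m → Fin n → Fin n → (k : ℕ) → (Fin (suc k) → Fin n) → Set
  IsPath T u v k c =
    Injective _≡_ _≡_ c × c zero ≡ u × c (fromℕ k) ≡ v ×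
    (∀ i → Adjacent T (c (inject₁ i)) (c (suc i)))

  -- k is the number of edges.
  Path : Subset m → Fin n → Fin n → ℕ → Set
  Path T u v k = ∃ (IsPath T u v k)

  Connected : Subset m → Set
  Connected T = NonZero n × (∀ u v → ∃ (Path T u v))

  -- A path with at least three vertices, closed up by one further edge.
  Cycle : Subset m → Set
  Cycle T = ∃₂ λ u v → ∃[ k ] Path T u v k × 2 ℕ.≤ k × Adjacent T v u

  SpanningTree : Subset m → Set
  SpanningTree T = Connected T × ¬ Cycle T

  IsConnected : Set
  IsConnected = Connected ⊤

------------------------------------------------------------------------
-- Being a spanning tree is decidable, by exhaustive search: a path has
-- fewer than n edges.

private
  ∃fun? : ∀ {k n p} {P : Pred (Fin k → Fin n) p} →
          (∀ {f g} → f ≗ g → P f → P g) → Decidable P → Dec (∃ P)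
  ∃fun? resp P? =
    map′ (λ (i , p) → finToFun i , p)
         (λ (f , p) → funToFin f , resp (λ x → sym (finToFun-funToFin f x)) p)
         (any? (P? ∘ finToFun))

  ∃<? : ∀ {p} {P : Pred ℕ p} b → (∀ {k} → P k → k ℕ.< b) → Decidable P → Dec (∃ P)
  ∃<? {P = P} b bound P? =
    map′ (λ (i , p) → toℕ i , p)
         (λ (k , p) → fromℕ< (bound p) , subst P (sym (toℕ-fromℕ< (bound p))) p)
         (any? {n = b} (P? ∘ toℕ))

  injective? : ∀ {k n} (c : Fin k → Fin n) → Dec (Injective _≡_ _≡_ c)
  injective? c =
    map′ (λ h {i} {j} → h i j) (λ h i j → h)
         (all? λ i → all? λ j → (c i ≟ c j) →-dec (i ≟ j))

module _ {n m : ℕ} (G : Graph n m) where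
  open Graph G

  private
    _≟ₑ_ : (p q : Fin n × Fin n) → Dec (p ≡ q)
    _≟ₑ_ = ≡-dec _≟_ _≟_

  adjacent? : ∀ T u v → Dec (Adjacent G T u v)
  adjacent? T u v = any? λ j →
    (j ∈? T) ×-dec ((endpoints j ≟ₑ (u , v)) ⊎-dec (endpoints j ≟ₑ (v , u)))

  private
    isPath-resp : ∀ {T u v k} {c d : Fin (suc k) → Fin n} →
                  c ≗ d → IsPath G T u v k c → IsPath G T u v k d
    isPath-resp {T} c≗d (inj , s , e , adj) =
      (λ {i} {j} eq → inj (trans (c≗d i) (trans eq (sym (c≗d j))))) ,
      trans (sym (c≗d _)) s ,
      trans (sym (c≗d _)) e ,
      λ i → subst₂ (Adjacent G T) (c≗d _) (c≗d _) (adj i)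

    path-bound : ∀ {T u v k} → Path G T u v k → k ℕ.< n
    path-bound (_ , inj , _) = injective⇒≤ inj

  path? : ∀ T u v k → Dec (Path G T u v k)
  path? T u v k = ∃fun? isPath-resp λ c →
    injective? c ×-dec (c zero ≟ u) ×-dec (c (fromℕ k) ≟ v) ×-dec
    all? λ i → adjacent? T (c (inject₁ i)) (c (suc i))

  connected? : ∀ T → Dec (Connected G T)
  connected? T =
    ℕₚ.nonZero? n ×-dec all? λ u → all? λ v → ∃<? n path-bound (path? T u v)

  cycle? : ∀ T → Dec (Cycle G T)
  cycle? T = any? λ u → any? λ v →
    ∃<? n (path-bound ∘ proj₁) λ k →
      path? T u v k ×-dec (2 ℕₚ.≤? k) ×-dec adjacent? T v u

  spanningTree? : Decidable (SpanningTree G)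
  spanningTree? T = connected? T ×-dec ¬? (cycle? T)

subsets : ∀ m → List (Subset m)
subsets zero    = [] ∷ []
subsets (suc m) = map (outside ∷_) (subsets m) ++ map (inside ∷_) (subsets m)

spanningTrees : ∀ {n m} → Graph n m → List (Subset m)
spanningTrees G = filter (spanningTree? G) (subsets _)

------------------------------------------------------------------------
-- The real numbers

-- The field ℝ is given by its axioms: a Cauchy complete Archimedean
-- ordered field, in the constructive formulation (_#_ is "invertible
-- difference"; classically it is the negation of _≈_).
record RealField c ℓ₁ ℓ₂ ℓ₃ : Set (lsuc (c ⊔ ℓ₁ ⊔ ℓ₂ ⊔ ℓ₃)) where
  infix 4 _<_ _≤_
  field
    heytingField : HeytingField c ℓ₁ ℓ₂

  open HeytingField heytingField public
    renaming (refl to ≈-refl; sym to ≈-sym; trans to ≈-trans; reflexive to ≈-reflexive)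

  commutativeRing : CommutativeRing c ℓ₁
  commutativeRing = HeytingCommutativeRing.commutativeRing heytingCommutativeRing

  open CommutativeRing commutativeRing public
    using (+-rawMonoid; *-rawMonoid)

  field
    _<_                  : Rel Carrier ℓ₃
    isStrictPartialOrder : IsStrictPartialOrder _≈_ _<_
    #⇔<⊎>                : ∀ {x y} → (x # y) ⇔ (x < y ⊎ y < x)
    +-monoˡ-<            : ∀ z {x y} → x < y → x + z < y + z
    *-pos                : ∀ {x y} → 0# < x → 0# < y → 0# < x * y

  _≤_ : Rel Carrier ℓ₃
  x ≤ y = ¬ (y < x)

  fromNat : ℕ → Carrier
  fromNat k = RawMonoidDefs._×_ +-rawMonoid k 1#

  -- ∣ x - y ∣ < ε
  Within : Carrier → Carrier → Carrier → Set ℓ₃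
  Within ε x y = (x - y < ε) × (y - x < ε)

  IsCauchy : (ℕ → Carrier) → Set (c ⊔ ℓ₃)
  IsCauchy s = ∀ ε → 0# < ε → ∃[ N ] ∀ i j → N ℕ.≤ i → N ℕ.≤ j → Within ε (s i) (s j)

  ConvergesTo : (ℕ → Carrier) → Carrier → Set (c ⊔ ℓ₃)
  ConvergesTo s l = ∀ ε → 0# < ε → ∃[ N ] ∀ i → N ℕ.≤ i → Within ε (s i) l

  field
    archimedean : ∀ x → ∃[ k ] x < fromNat k
    complete    : ∀ s → IsCauchy s → ∃[ l ] ConvergesTo s l

  -- _#_ inverts the difference b - 0#, which is b up to _≈_.
  infixl 7 _/⟨_⟩
  _/⟨_⟩ : ∀ {b} → Carrier → b # 0# → Carrier
  a /⟨ b#0 ⟩ = a * proj₁ (#⇒invertible b#0)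

  ∑ : ∀ {k} → Vector Carrier k → Carrier
  ∑ = RawMonoidDefs.sum +-rawMonoid

  ∏ : ∀ {k} → Vector Carrier k → Carrier
  ∏ = RawMonoidDefs.sum *-rawMonoid

------------------------------------------------------------------------
-- Derivatives of functions ℝᵐ → ℝ

module _ {c ℓ₁ ℓ₂ ℓ₃} (R : RealField c ℓ₁ ℓ₂ ℓ₃) where
  open RealField R

  -- lim_{t → 0} (f (x + t y) - f x) / t = d
  DirectionalDerivative : ∀ {m} → (Vector Carrier m → Carrier) →
    Vector Carrier m → Vector Carrier m → Carrier → Set (c ⊔ ℓ₂ ⊔ ℓ₃)
  DirectionalDerivative f x y d =
    ∀ ε → 0# < ε → ∃[ δ ] 0# < δ × (∀ t (t#0 : t # 0#) → Within δ t 0# →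
      Within ε ((f (λ j → x j + t * y j) - f x) /⟨ t#0 ⟩) d)

  unitVector : ∀ {m} → Fin m → Vector Carrier m
  unitVector j i = if does (i ≟ j) then 1# else 0#

  PartialDerivative : ∀ {m} → (Vector Carrier m → Carrier) →
    Vector Carrier m → Fin m → Carrier → Set (c ⊔ ℓ₂ ⊔ ℓ₃)
  PartialDerivative f x j d = DirectionalDerivative f x (unitVector j) d

------------------------------------------------------------------------
-- The weighted tree number

  InWeightedEdgePolytope : ∀ {m} → Vector Carrier m → Set (ℓ₁ ⊔ ℓ₃)
  InWeightedEdgePolytope {m} x = (∀ j → 0# ≤ x j) × ∑ x ≈ fromNat m

  treeNumber : ∀ {n m} → Graph n m → Vector Carrier m → Carrier
  treeNumber G x =
    foldr _+_ 0# (map (λ T → ∏ (λ j → if lookup T j then x j else 1#)) (spanningTrees G))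

  CriticalPoint : ∀ {n m} → Graph n m → Vector Carrier m → Set (c ⊔ ℓ₁ ⊔ ℓ₂ ⊔ ℓ₃)
  CriticalPoint G x = ∀ y → ∑ y ≈ 0# → DirectionalDerivative (treeNumber G) x y 0#

  -- r is the effective resistance τⱼ(x) / τ(x) of the edge j.
  EffectiveResistance : ∀ {n m} (G : Graph n m) (x : Vector Carrier m) →
    treeNumber G x # 0# → Fin m → Carrier → Set (c ⊔ ℓ₁ ⊔ ℓ₂ ⊔ ℓ₃)
  EffectiveResistance G x τ#0 j r =
    ∃[ τⱼ ] PartialDerivative (treeNumber G) x j τⱼ × r ≈ τⱼ /⟨ τ#0 ⟩

module Submission where

-- Along a line t ↦ x + t y a polynomial f has an expansion
-- f(x) + t (⟨ y , ∇f(x) ⟩ + t q(t)) with q bounded for ∣ t ∣ < 1; this form is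
-- stable under sums and products, and it shows that ⟨ y , ∇f(x) ⟩ is the
-- directional derivative. Hence x is critical for τ iff ∇τ(x) is orthogonal to
-- every y with ∑ y = 0, i.e. (test y = eᵢ - eⱼ) iff all the τⱼ(x) agree.

open import Defs
open import Algebra.Apartness.Bundles using (HeytingField)
open import Algebra.Bundles using (CommutativeRing)
open import Data.Bool.Base using (Bool; true; false; if_then_else_)
open import Data.Empty using (⊥-elim)
open import Data.Fin.Base using (Fin; zero; suc)
open import Data.List.Base using ([]; _∷_; foldr; map)
open import Data.Nat.Base using (ℕ; zero; suc)
open import Data.Product.Base using (∃; ∃-syntax; _×_; _,_; proj₁; proj₂)
open import Data.Sum.Base using (inj₁; inj₂; [_,_]′)
open import Data.Vec.Base using (lookup)
open import Data.Vec.Functional using (Vector; tail)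
open import Function.Base using (_∘_)
open import Function.Bundles using (_⇔_; Equivalence; mk⇔)
open import Level using (_⊔_)
open import Relation.Binary.Structures using (IsStrictPartialOrder)
open import Relation.Nullary using (¬_)

module _ {c ℓ₁ ℓ₂ ℓ₃} (R : RealField c ℓ₁ ℓ₂ ℓ₃) where
  open RealField R hiding (zero)
  private
    module CR = CommutativeRing commutativeRing
    module <ₚ = IsStrictPartialOrder isStrictPartialOrder

  open import Algebra.Apartness.Properties.HeytingCommutativeRing
    (HeytingField.heytingCommutativeRing heytingField) using (x-0≈x; 1#0)
  open import Algebra.Properties.Ring CR.ring
    using (-‿involutive; -‿distribˡ-*; -‿distribʳ-*; //-rightDividesˡ; -1*x≈-x; x[y-z]≈xy-xz)
  open import Algebra.Properties.AbelianGroup CR.+-abelianGroup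
    using (⁻¹-∙-comm; ⁻¹-anti-homo‿-)
  open import Algebra.Properties.Semiring.Sum CR.semiring
    using (sum-cong-≋; ∑-distrib-+; *-distribˡ-sum)
  open import Algebra.Solver.Ring.NaturalCoefficients.Default CR.commutativeSemiring
    using (solve; _:=_; _:+_; _:*_; con)
  open import Relation.Binary.Reasoning.Setoid CR.setoid

  private variable
    a b x y z w ε B C : Carrier
    m : ℕ

  -- Ordered field arithmetic

  <-resp : x ≈ y → z ≈ w → x < z → y < w
  <-resp x≈y z≈w x<z = <ₚ.<-respˡ-≈ x≈y (<ₚ.<-respʳ-≈ z≈w x<z)

  +-mono-< : x < y → z < w → x + z < y + w
  +-mono-< {x} {y} {z} {w} x<y z<w =
    <ₚ.trans (+-monoˡ-< z x<y) (<-resp (+-comm z y) (+-comm w y) (+-monoˡ-< y z<w))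

  +-pos : 0# < x → 0# < y → 0# < x + y
  +-pos 0<x 0<y = <ₚ.<-respˡ-≈ (+-identityˡ 0#) (+-mono-< 0<x 0<y)

  x<y⇒0<y-x : x < y → 0# < y - x
  x<y⇒0<y-x {x} x<y = <ₚ.<-respˡ-≈ (-‿inverseʳ x) (+-monoˡ-< (- x) x<y)

  0<y-x⇒x<y : 0# < y - x → x < y
  0<y-x⇒x<y {y} {x} 0<y-x =
    <-resp (+-identityˡ x) (//-rightDividesˡ x y) (+-monoˡ-< x 0<y-x)

  *-monoʳ-< : 0# < z → x < y → z * x < z * y
  *-monoʳ-< {z} {x} {y} 0<z x<y =
    0<y-x⇒x<y (<ₚ.<-respʳ-≈ (x[y-z]≈xy-xz z y x) (*-pos 0<z (x<y⇒0<y-x x<y)))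

  *-monoˡ-< : 0# < z → x < y → x * z < y * z
  *-monoˡ-< {z} {x} {y} 0<z x<y = <-resp (*-comm z x) (*-comm z y) (*-monoʳ-< 0<z x<y)

  x<0⇒0<-x : x < 0# → 0# < - x
  x<0⇒0<-x {x} x<0 = <ₚ.<-respʳ-≈ (+-identityˡ (- x)) (x<y⇒0<y-x x<0)

  0<x⇒-x<0 : 0# < x → - x < 0#
  0<x⇒-x<0 {x} 0<x = <-resp (+-identityˡ (- x)) (-‿inverseʳ x) (+-monoˡ-< (- x) 0<x)

  -- Apartness of `1#` and `0#` leaves two orders; under `1# < 0#`, the element `1#` is the square
  -- of the positive element `- 1#`.
  0<1 : 0# < 1#
  0<1 with Equivalence.to #⇔<⊎> 1#0
  ... | inj₂ 0<1 = 0<1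
  ... | inj₁ 1<0 = <ₚ.<-respʳ-≈ -1*-1≈1 (*-pos (x<0⇒0<-x 1<0) (x<0⇒0<-x 1<0))
    where
    -1*-1≈1 : - 1# * - 1# ≈ 1#
    -1*-1≈1 = ≈-trans (-1*x≈-x (- 1#)) (-‿involutive 1#)

  -- The order is not decidable, so `x` is located by cotransitivity: `0# # x + x` gives `0# # x` or
  -- `x # x + x`. Among the four resulting orders, `x < 0#` is absurd and each of the others yields
  -- `0# < x`.
  0<x+x⇒0<x : 0# < x + x → 0# < x
  0<x+x⇒0<x {x} 0<x+x with #-cotrans (Equivalence.from #⇔<⊎> (inj₁ 0<x+x)) x
  ... | inj₁ 0#x = [ (λ 0<x → 0<x) , (λ x<0 → ⊥-elim (x≮0 x<0)) ]′ (Equivalence.to #⇔<⊎> 0#x)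
    where
    x≮0 : ¬ x < 0#
    x≮0 x<0 = <ₚ.asym 0<x+x (<ₚ.<-respʳ-≈ (+-identityˡ 0#) (+-mono-< x<0 x<0))
  ... | inj₂ x#x+x with Equivalence.to #⇔<⊎> x#x+x
  ...   | inj₁ x<x+x = <ₚ.<-respʳ-≈ x+x-x≈x (x<y⇒0<y-x x<x+x)
    where
    x+x-x≈x : x + x - x ≈ x
    x+x-x≈x = ≈-trans (+-assoc x x (- x)) (≈-trans (+-congˡ (-‿inverseʳ x)) (+-identityʳ x))
  ...   | inj₂ x+x<x = <ₚ.trans 0<x+x x+x<x

  positive⇒#0 : 0# < x → x # 0#
  positive⇒#0 0<x = Equivalence.from #⇔<⊎> (inj₂ 0<x)

  /-inverse : (b#0 : b # 0#) → b * proj₁ (#⇒invertible b#0) ≈ 1#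
  /-inverse b#0 = ≈-trans (*-congʳ (≈-sym (x-0≈x _))) (proj₂ (proj₂ (#⇒invertible b#0)))

  -- The inverse is itself invertible, hence apart from `0#`; it is not negative, since `x * x⁻¹`
  -- would then make `1#` negative.
  reciprocal : 0# < x → ∃[ z ] 0# < z × x * z ≈ 1#
  reciprocal {x} 0<x = x⁻¹ , 0<x⁻¹ , xx⁻¹≈1
    where
    x⁻¹ : Carrier
    x⁻¹ = proj₁ (#⇒invertible (positive⇒#0 0<x))

    xx⁻¹≈1 : x * x⁻¹ ≈ 1#
    xx⁻¹≈1 = /-inverse (positive⇒#0 0<x)

    x⁻¹≮0 : ¬ x⁻¹ < 0#
    x⁻¹≮0 x⁻¹<0 = <ₚ.asym 0<1
      (<-resp xx⁻¹≈1 (zeroʳ x) (*-monoʳ-< 0<x x⁻¹<0))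

    x⁻¹#0 : x⁻¹ # 0#
    x⁻¹#0 = invertible⇒# (x , ≈-trans (*-congˡ (x-0≈x x⁻¹)) xx⁻¹≈1
                          , ≈-trans (*-comm _ x) (≈-trans (*-congˡ (x-0≈x x⁻¹)) xx⁻¹≈1))

    0<x⁻¹ : 0# < x⁻¹
    0<x⁻¹ = [ (λ x⁻¹<0 → ⊥-elim (x⁻¹≮0 x⁻¹<0)) , (λ 0<x⁻¹ → 0<x⁻¹) ]′ (Equivalence.to #⇔<⊎> x⁻¹#0)

  half : 0# < x → ∃[ h ] 0# < h × h + h ≈ x
  half {x} 0<x with z , 0<z , 2z≈1 ← reciprocal (+-pos 0<1 0<1) =
    x * z , *-pos 0<x 0<z , (begin
      x * z + x * z        ≈⟨ solve 2 (λ x z → x :* z :+ x :* z := x :* ((con 1 :+ con 1) :* z)) ≈-refl x z ⟩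
      x * ((1# + 1#) * z)  ≈⟨ *-congˡ 2z≈1 ⟩
      x * 1#               ≈⟨ *-identityʳ x ⟩
      x                    ∎)

  -- The witness is a / (a + b).
  scale-below : 0# < a → 0# < b → ∃[ s ] 0# < s × s < 1# × s * b < a
  scale-below {a} {b} 0<a 0<b with z , 0<z , [a+b]z≈1 ← reciprocal (+-pos 0<a 0<b) =
    a * z , *-pos 0<a 0<z ,
    <ₚ.<-respʳ-≈ [a+b]z≈1 (*-monoˡ-< 0<z a<a+b) ,
    <-resp (solve 3 (λ a b z → a :* (b :* z) := a :* z :* b) ≈-refl a b z) (*-identityʳ a)
      (*-monoʳ-< 0<a (<ₚ.<-respʳ-≈ [a+b]z≈1 (*-monoˡ-< 0<z b<a+b)))
    where
    a<a+b : a < a + b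
    a<a+b = <-resp (+-identityˡ a) (+-comm b a) (+-monoˡ-< a 0<b)

    b<a+b : b < a + b
    b<a+b = <ₚ.<-respˡ-≈ (+-identityˡ b) (+-monoˡ-< b 0<a)

  -- Absolute value bounds

  infix 4 ∣_∣<_
  -- Two strict inequalities replace an absolute value, whose definition by cases would require
  -- deciding the sign of `x`.
  ∣_∣<_ : Carrier → Carrier → Set ℓ₃
  ∣ x ∣< B = x < B × - x < B

  ∣∣<-resp : x ≈ y → ∣ x ∣< B → ∣ y ∣< B
  ∣∣<-resp x≈y (x<B , -x<B) = <ₚ.<-respˡ-≈ x≈y x<B , <ₚ.<-respˡ-≈ (-‿cong x≈y) -x<B

  ∣∣<-trans : ∣ x ∣< B → B < C → ∣ x ∣< C
  ∣∣<-trans (x<B , -x<B) B<C = <ₚ.trans x<B B<C , <ₚ.trans -x<B B<C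

  positive⇒∣∣< : 0# < x → x < B → ∣ x ∣< B
  positive⇒∣∣< 0<x x<B = x<B , <ₚ.trans (0<x⇒-x<0 0<x) (<ₚ.trans 0<x x<B)

  ∣∣<-+ : ∣ x ∣< B → ∣ y ∣< C → ∣ x + y ∣< B + C
  ∣∣<-+ {x} {y = y} (x<B , -x<B) (y<C , -y<C) =
    +-mono-< x<B y<C , <ₚ.<-respˡ-≈ (⁻¹-∙-comm x y) (+-mono-< -x<B -y<C)

  -- 2 (B C - x y) = (B - x) (C + y) + (B + x) (C - y)
  *-upper-bound : ∣ x ∣< B → ∣ y ∣< C → x * y < B * C
  *-upper-bound {x} {B} {y} {C} (x<B , -x<B) (y<C , -y<C) =
    0<y-x⇒x<y (0<x+x⇒0<x (<ₚ.<-respʳ-≈ eq (+-pos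
      (*-pos (x<y⇒0<y-x x<B) (x<y⇒0<y-x -y<C))
      (*-pos (x<y⇒0<y-x -x<B) (x<y⇒0<y-x y<C)))))
    where
    eq : (B - x) * (C - - y) + (B - - x) * (C - y) ≈ (B * C - x * y) + (B * C - x * y)
    eq = begin
      (B - x) * (C - - y) + (B - - x) * (C - y)
        ≈⟨ +-cong (*-congˡ (+-congˡ (-‿involutive y))) (*-congʳ (+-congˡ (-‿involutive x))) ⟩
      (B + - x) * (C + y) + (B + x) * (C + - y)
        ≈⟨ solve 6 (λ B C x x′ y y′ →
             (B :+ x′) :* (C :+ y) :+ (B :+ x) :* (C :+ y′) :=
             ((B :* C :+ x′ :* y) :+ (B :* C :+ x :* y′)) :+ (B :* (y :+ y′) :+ C :* (x :+ x′)))
           ≈-refl B C x (- x) y (- y) ⟩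
      ((B * C + - x * y) + (B * C + x * - y)) + (B * (y - y) + C * (x - x))
        ≈⟨ +-cong
             (+-cong (+-congˡ (≈-sym (-‿distribˡ-* x y))) (+-congˡ (≈-sym (-‿distribʳ-* x y))))
             (+-cong (≈-trans (*-congˡ (-‿inverseʳ y)) (zeroʳ B))
                     (≈-trans (*-congˡ (-‿inverseʳ x)) (zeroʳ C))) ⟩
      ((B * C - x * y) + (B * C - x * y)) + (0# + 0#)
        ≈⟨ ≈-trans (+-congˡ (+-identityˡ 0#)) (+-identityʳ _) ⟩
      (B * C - x * y) + (B * C - x * y) ∎

  -- The bound on `- (x * y)` is the upper bound applied to `- x` and `y`.
  ∣∣<-* : ∣ x ∣< B → ∣ y ∣< C → ∣ x * y ∣< B * C
  ∣∣<-* {x} {y = y} (x<B , -x<B) y<C =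
    *-upper-bound (x<B , -x<B) y<C ,
    <ₚ.<-respˡ-≈ (≈-sym (-‿distribˡ-* x y))
      (*-upper-bound (-x<B , <ₚ.<-respˡ-≈ (≈-sym (-‿involutive x)) x<B) y<C)

  ∣∣<⇒Within : ∣ x - y ∣< ε → Within ε x y
  ∣∣<⇒Within {x} {y} (x-y<ε , y-x<ε) = x-y<ε , <ₚ.<-respˡ-≈ (⁻¹-anti-homo‿- x y) y-x<ε

  Within⇒∣∣< : Within ε x y → ∣ x - y ∣< ε
  Within⇒∣∣< {x = x} {y} (x-y<ε , y-x<ε) =
    x-y<ε , <ₚ.<-respˡ-≈ (≈-sym (⁻¹-anti-homo‿- x y)) y-x<ε

  fromNat-suc-positive : ∀ k → 0# < fromNat (suc k)
  fromNat-suc-positive zero    = <ₚ.<-respʳ-≈ (≈-sym (+-identityʳ 1#)) 0<1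
  fromNat-suc-positive (suc k) = +-pos 0<1 (fromNat-suc-positive k)

  -- Functions bounded near zero

  -- The radius is fixed at `1#`, so that sums and products need no minimum of radii.
  BoundedNear0 : (Carrier → Carrier) → Set (c ⊔ ℓ₃)
  BoundedNear0 q = ∃[ B ] 0# < B × (∀ t → ∣ t ∣< 1# → ∣ q t ∣< B)

  -- The sum of a natural number above `x` and one above `- x` serves in place of their maximum;
  -- taking successors makes both summands positive.
  bounded-const : ∀ x → BoundedNear0 (λ _ → x)
  bounded-const x =
    let k , x<k  = archimedean x
        l , -x<l = archimedean (- x)
        0<k+1    = fromNat-suc-positive k
        0<l+1    = fromNat-suc-positive l
    in fromNat (suc k) + fromNat (suc l) , +-pos 0<k+1 0<l+1 , λ _ _ →
       <-resp (+-identityʳ x) ≈-refl (+-mono-< (<ₚ.trans x<k (fromNat<suc k)) 0<l+1) ,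
       <-resp (+-identityˡ (- x)) ≈-refl (+-mono-< 0<k+1 (<ₚ.trans -x<l (fromNat<suc l)))
    where
    fromNat<suc : ∀ k → fromNat k < fromNat (suc k)
    fromNat<suc k = <ₚ.<-respˡ-≈ (+-identityˡ (fromNat k)) (+-monoˡ-< (fromNat k) 0<1)

  bounded-id : BoundedNear0 (λ t → t)
  bounded-id = 1# , 0<1 , λ _ t<1 → t<1

  module _ {p q : Carrier → Carrier} where
    bounded-+ : BoundedNear0 p → BoundedNear0 q → BoundedNear0 (λ t → p t + q t)
    bounded-+ (B , 0<B , p<B) (C , 0<C , q<C) =
      B + C , +-pos 0<B 0<C , λ t t<1 → ∣∣<-+ (p<B t t<1) (q<C t t<1)

    bounded-* : BoundedNear0 p → BoundedNear0 q → BoundedNear0 (λ t → p t * q t)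
    bounded-* (B , 0<B , p<B) (C , 0<C , q<C) =
      B * C , *-pos 0<B 0<C , λ t t<1 → ∣∣<-* (p<B t t<1) (q<C t t<1)

  -- First-order expansions and gradients

  -- Used with `e = t * q t`: it turns an expansion into the exact error of the difference quotient.
  differenceQuotient-error : ∀ {t d e} (t#0 : t # 0#) → b ≈ a + t * (d + e) →
    (b - a) /⟨ t#0 ⟩ - d ≈ e
  differenceQuotient-error {b} {a} {t} {d} {e} t#0 b≈ = begin
    (b - a) * t⁻¹ - d
      ≈⟨ +-congʳ (*-congʳ (+-congʳ b≈)) ⟩
    ((a + t * (d + e)) - a) * t⁻¹ - d
      -- A semiring identity in which `- a` and `- d` are independent variables; the cancellations
      -- follow separately.
      ≈⟨ solve 7 (λ a a′ t t⁻¹ d d′ e →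
           ((a :+ t :* (d :+ e)) :+ a′) :* t⁻¹ :+ d′ :=
           (a :+ a′) :* t⁻¹ :+ ((t :* t⁻¹) :* (d :+ e) :+ d′))
         ≈-refl a (- a) t t⁻¹ d (- d) e ⟩
    (a - a) * t⁻¹ + ((t * t⁻¹) * (d + e) - d)
      ≈⟨ +-cong (*-congʳ (-‿inverseʳ a)) (+-congʳ (*-congʳ (/-inverse t#0))) ⟩
    0# * t⁻¹ + (1# * (d + e) - d)
      ≈⟨ solve 4 (λ t⁻¹ d d′ e →
           con 0 :* t⁻¹ :+ (con 1 :* (d :+ e) :+ d′) := (d :+ d′) :+ e)
         ≈-refl t⁻¹ d (- d) e ⟩
    (d - d) + e
      ≈⟨ ≈-trans (+-congʳ (-‿inverseʳ d)) (+-identityˡ e) ⟩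
    e ∎
    where
    t⁻¹ : Carrier
    t⁻¹ = proj₁ (#⇒invertible t#0)

  -- The identity is required for every `t`; only the bound on `q` is local.
  Expansion : (Carrier → Carrier) → Carrier → Carrier → Set (c ⊔ ℓ₁ ⊔ ℓ₃)
  Expansion φ a d = ∃[ q ] BoundedNear0 q × (∀ t → φ t ≈ a + t * (d + t * q t))

  line : Vector Carrier m → Vector Carrier m → Carrier → Vector Carrier m
  line x y t j = x j + t * y j

  ⟨_,_⟩ : Vector Carrier m → Vector Carrier m → Carrier
  ⟨ y , g ⟩ = ∑ (λ j → y j * g j)

  -- A single `g` serves all directions, which makes the derivative linear in `y`; the remainder may
  -- depend on `y`.
  HasGradient : (Vector Carrier m → Carrier) → Vector Carrier m → Vector Carrier m →
                Set (c ⊔ ℓ₁ ⊔ ℓ₃)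
  HasGradient f x g = ∀ y → Expansion (f ∘ line x y) (f x) ⟨ y , g ⟩

  Differentiable : (Vector Carrier m → Carrier) → Vector Carrier m → Set (c ⊔ ℓ₁ ⊔ ℓ₃)
  Differentiable f x = ∃ (HasGradient f x)

  ⟨⟩-comm : (y g : Vector Carrier m) → ⟨ y , g ⟩ ≈ ⟨ g , y ⟩
  ⟨⟩-comm y g = sum-cong-≋ λ j → *-comm (y j) (g j)

  ⟨⟩-+ʳ : (y g h : Vector Carrier m) → ⟨ y , (λ j → g j + h j) ⟩ ≈ ⟨ y , g ⟩ + ⟨ y , h ⟩
  ⟨⟩-+ʳ y g h = ≈-trans (sum-cong-≋ λ j → distribˡ (y j) (g j) (h j))
                        (∑-distrib-+ (λ j → y j * g j) (λ j → y j * h j))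

  ⟨⟩-*ʳ : ∀ a (y g : Vector Carrier m) → ⟨ y , (λ j → a * g j) ⟩ ≈ a * ⟨ y , g ⟩
  ⟨⟩-*ʳ a y g = ≈-trans
    (sum-cong-≋ λ j → solve 3 (λ a y g → y :* (a :* g) := a :* (y :* g)) ≈-refl a (y j) (g j))
    (≈-sym (*-distribˡ-sum a (λ j → y j * g j)))

  ⟨⟩-zeroʳ : (y : Vector Carrier m) → ⟨ y , (λ _ → 0#) ⟩ ≈ 0#
  ⟨⟩-zeroʳ {zero}  y = ≈-refl
  ⟨⟩-zeroʳ {suc m} y = ≈-trans (+-cong (zeroʳ (y zero)) (⟨⟩-zeroʳ (tail y))) (+-identityˡ 0#)

  -- This is the Lagrange condition in the direction from equal partial derivatives to a critical
  -- point.
  ⟨⟩-constʳ : (y : Vector Carrier m) → ∑ y ≈ 0# → ⟨ y , (λ _ → a) ⟩ ≈ 0#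
  ⟨⟩-constʳ {a = a} y ∑y≈0 = begin
    ⟨ y , (λ _ → a) ⟩  ≈⟨ sum-cong-≋ (λ j → *-comm (y j) a) ⟩
    ∑ (λ j → a * y j)  ≈⟨ *-distribˡ-sum a y ⟨
    a * ∑ y            ≈⟨ *-congˡ ∑y≈0 ⟩
    a * 0#             ≈⟨ zeroʳ a ⟩
    0#                 ∎

  ⟨⟩-unitVectorʳ : (y : Vector Carrier m) (j : Fin m) → ⟨ y , unitVector R j ⟩ ≈ y j
  ⟨⟩-unitVectorʳ y zero    =
    ≈-trans (+-cong (*-identityʳ (y zero)) (⟨⟩-zeroʳ (tail y))) (+-identityʳ (y zero))
  -- `does (suc i ≟ suc j)` reduces to `does (i ≟ j)`, so the tail of `unitVector R (suc j)` is
  -- `unitVector R j`.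
  ⟨⟩-unitVectorʳ y (suc j) =
    ≈-trans (+-cong (zeroʳ (y zero)) (⟨⟩-unitVectorʳ (tail y) j)) (+-identityˡ (y (suc j)))

  ⟨⟩-unitVectorˡ : (j : Fin m) (g : Vector Carrier m) → ⟨ unitVector R j , g ⟩ ≈ g j
  ⟨⟩-unitVectorˡ j g = ≈-trans (⟨⟩-comm (unitVector R j) g) (⟨⟩-unitVectorʳ g j)

  -- Differentiability of the tree number

  module _ (x : Vector Carrier m) where

    differentiable-const : ∀ a → Differentiable (λ _ → a) x
    differentiable-const a = (λ _ → 0#) , λ y → (λ _ → 0#) , bounded-const 0# , λ t → begin
      a                                      ≈⟨ solve 2 (λ a t → a := a :+ t :* (con 0 :+ t :* con 0)) ≈-refl a t ⟩
      a + t * (0# + t * 0#)                  ≈⟨ +-congˡ (*-congˡ (+-congʳ (⟨⟩-zeroʳ y))) ⟨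
      a + t * (⟨ y , (λ _ → 0#) ⟩ + t * 0#)  ∎

    -- A coordinate is affine along every line, so the remainder is zero.
    differentiable-coordinate : ∀ j → Differentiable (λ z → z j) x
    differentiable-coordinate j = unitVector R j , λ y → (λ _ → 0#) , bounded-const 0# , λ t → begin
      x j + t * y j
        ≈⟨ solve 3 (λ x t y → x :+ t :* y := x :+ t :* (y :+ t :* con 0)) ≈-refl (x j) t (y j) ⟩
      x j + t * (y j + t * 0#)
        ≈⟨ +-congˡ (*-congˡ (+-congʳ (⟨⟩-unitVectorʳ y j))) ⟨
      x j + t * (⟨ y , unitVector R j ⟩ + t * 0#) ∎

    module _ (f g : Vector Carrier m → Carrier) where

      differentiable-+ : Differentiable f x → Differentiable g x → Differentiable (λ z → f z + g z) x
      differentiable-+ (∇f , hf) (∇g , hg) = (λ j → ∇f j + ∇g j) , λ y →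
        let p , p-bounded , f≈ = hf y
            q , q-bounded , g≈ = hg y
        in (λ t → p t + q t) , bounded-+ p-bounded q-bounded , λ t → begin
          f (line x y t) + g (line x y t)
            ≈⟨ +-cong (f≈ t) (g≈ t) ⟩
          (f x + t * (⟨ y , ∇f ⟩ + t * p t)) + (g x + t * (⟨ y , ∇g ⟩ + t * q t))
            ≈⟨ solve 7 (λ f g d e t p q →
                 (f :+ t :* (d :+ t :* p)) :+ (g :+ t :* (e :+ t :* q)) :=
                 (f :+ g) :+ t :* ((d :+ e) :+ t :* (p :+ q)))
               ≈-refl (f x) (g x) ⟨ y , ∇f ⟩ ⟨ y , ∇g ⟩ t (p t) (q t) ⟩
          (f x + g x) + t * ((⟨ y , ∇f ⟩ + ⟨ y , ∇g ⟩) + t * (p t + q t))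
            ≈⟨ +-congˡ (*-congˡ (+-congʳ (⟨⟩-+ʳ y ∇f ∇g))) ⟨
          (f x + g x) + t * (⟨ y , (λ j → ∇f j + ∇g j) ⟩ + t * (p t + q t)) ∎

      differentiable-* : Differentiable f x → Differentiable g x → Differentiable (λ z → f z * g z) x
      differentiable-* (∇f , hf) (∇g , hg) = (λ j → f x * ∇g j + g x * ∇f j) , λ y →
        let p , p-bounded , f≈ = hf y
            q , q-bounded , g≈ = hg y
            d = ⟨ y , ∇f ⟩
            e = ⟨ y , ∇g ⟩
        -- With increments `t * U` and `t * V`, where `U = d + t * p t` and `V = e + t * q t`, the
        -- terms of order at least two are `t * t` times this: `f x * q t + g x * p t` comes from
        -- the mixed terms and `U * V` from the product of the increments.
        in (λ t → (f x * q t + g x * p t) + (d + t * p t) * (e + t * q t)) ,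
           bounded-+
             (bounded-+ (bounded-* (bounded-const (f x)) q-bounded)
                        (bounded-* (bounded-const (g x)) p-bounded))
             (bounded-* (bounded-+ (bounded-const d) (bounded-* bounded-id p-bounded))
                        (bounded-+ (bounded-const e) (bounded-* bounded-id q-bounded))) ,
           λ t → begin
          f (line x y t) * g (line x y t)
            ≈⟨ *-cong (f≈ t) (g≈ t) ⟩
          (f x + t * (d + t * p t)) * (g x + t * (e + t * q t))
            ≈⟨ solve 7 (λ f g d e t p q →
                 (f :+ t :* (d :+ t :* p)) :* (g :+ t :* (e :+ t :* q)) :=
                 f :* g :+ t :* ((f :* e :+ g :* d) :+
                   t :* ((f :* q :+ g :* p) :+ (d :+ t :* p) :* (e :+ t :* q))))
               ≈-refl (f x) (g x) d e t (p t) (q t) ⟩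
          f x * g x + t * ((f x * e + g x * d) + t * _)
            ≈⟨ +-congˡ (*-congˡ (+-congʳ (gradient-* y))) ⟨
          f x * g x + t * (⟨ y , (λ j → f x * ∇g j + g x * ∇f j) ⟩ + t * _) ∎
        where
        gradient-* : ∀ y → ⟨ y , (λ j → f x * ∇g j + g x * ∇f j) ⟩ ≈ f x * ⟨ y , ∇g ⟩ + g x * ⟨ y , ∇f ⟩
        gradient-* y = ≈-trans (⟨⟩-+ʳ y (λ j → f x * ∇g j) (λ j → g x * ∇f j))
                               (+-cong (⟨⟩-*ʳ (f x) y ∇g) (⟨⟩-*ʳ (g x) y ∇f))

    differentiable-∏ : ∀ {k} (f : Fin k → Vector Carrier m → Carrier) →
                       (∀ i → Differentiable (f i) x) → Differentiable (λ z → ∏ (λ i → f i z)) x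
    differentiable-∏ {zero}  f hf = differentiable-const 1#
    differentiable-∏ {suc k} f hf =
      differentiable-* (f zero) (λ z → ∏ (λ i → f (suc i) z))
        (hf zero) (differentiable-∏ (f ∘ suc) (hf ∘ suc))

    differentiable-foldr : ∀ {i} {I : Set i} (f : I → Vector Carrier m → Carrier) →
                           (∀ i → Differentiable (f i) x) → ∀ is →
                           Differentiable (λ z → foldr _+_ 0# (map (λ i → f i z) is)) x
    differentiable-foldr f hf []       = differentiable-const 0#
    differentiable-foldr f hf (i ∷ is) =
      differentiable-+ (f i) (λ z → foldr _+_ 0# (map (λ i → f i z) is))
        (hf i) (differentiable-foldr f hf is)

    -- The tree number is built from coordinates and ones by finite products and sums.
    differentiable-treeNumber : ∀ {n} (G : Graph n m) → Differentiable (treeNumber R G) x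
    differentiable-treeNumber G =
      differentiable-foldr (λ T z → ∏ (λ j → factor j (lookup T j) z))
        (λ T → differentiable-∏ (λ j → factor j (lookup T j))
                              (λ j → differentiable-factor j (lookup T j)))
        (spanningTrees G)
      where
      -- The membership bit is an argument, so that differentiability can be proved by cases on it.
      factor : Fin m → Bool → Vector Carrier m → Carrier
      factor j b z = if b then z j else 1#

      differentiable-factor : ∀ j b → Differentiable (factor j b) x
      differentiable-factor j true  = differentiable-coordinate j
      differentiable-factor j false = differentiable-const 1#

  -- Directional derivatives: existence and uniqueness

  module _ (f : Vector Carrier m → Carrier) (x : Vector Carrier m) where

    directionalDerivative-resp : ∀ {y d e} → d ≈ e →
      DirectionalDerivative R f x y d → DirectionalDerivative R f x y e
    directionalDerivative-resp d≈e D ε 0<ε with δ , 0<δ , near ← D ε 0<ε =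
      δ , 0<δ , λ t t#0 t<δ →
        let s-d<ε , d-s<ε = near t t#0 t<δ
        in <ₚ.<-respˡ-≈ (+-congˡ (-‿cong d≈e)) s-d<ε , <ₚ.<-respˡ-≈ (+-congʳ d≈e) d-s<ε

    gradient⇒directionalDerivative : ∀ {g} → HasGradient f x g →
      ∀ y → DirectionalDerivative R f x y ⟨ y , g ⟩
    gradient⇒directionalDerivative hf y ε 0<ε =
      let q , (B , 0<B , q<B) , f≈ = hf y
          -- `δ < 1#` makes the bound on `q` available, and `δ * B < ε` then controls the error
          -- `t * q t`.
          δ , 0<δ , δ<1 , δB<ε = scale-below 0<ε 0<B
      in δ , 0<δ , λ t t#0 t-near →
         let t<δ = ∣∣<-resp (x-0≈x t) (Within⇒∣∣< t-near)
         in ∣∣<⇒Within (∣∣<-resp (≈-sym (differenceQuotient-error t#0 (f≈ t)))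
              (∣∣<-trans (∣∣<-* t<δ (q<B t (∣∣<-trans t<δ δ<1))) δB<ε))

    -- Here `u` is the difference quotient at the increment `s * δ₂`, which lies below both radii
    -- and so stands in for their minimum.
    common-approximation : ∀ {y d e h} →
      DirectionalDerivative R f x y d → DirectionalDerivative R f x y e → 0# < h →
      ∃[ u ] Within h u d × Within h u e
    common-approximation {h = h} D E 0<h =
      let δ₁ , 0<δ₁ , near-d = D h 0<h
          δ₂ , 0<δ₂ , near-e = E h 0<h
          s , 0<s , s<1 , sδ₂<δ₁ = scale-below 0<δ₁ 0<δ₂
          0<t = *-pos 0<s 0<δ₂
          t<δ₂ = <ₚ.<-respʳ-≈ (*-identityˡ δ₂) (*-monoˡ-< 0<δ₂ s<1)
          t#0 = positive⇒#0 0<t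
      in _ , near-d (s * δ₂) t#0 (within-0 0<t sδ₂<δ₁) , near-e (s * δ₂) t#0 (within-0 0<t t<δ₂)
      where
      within-0 : ∀ {t δ} → 0# < t → t < δ → Within δ t 0#
      within-0 {t} 0<t t<δ = ∣∣<⇒Within (∣∣<-resp (≈-sym (x-0≈x t)) (positive⇒∣∣< 0<t t<δ))

    -- With `h` half of `e - d`, a common approximation `u` satisfies `u - d < h` and `e - u < h`;
    -- adding these gives `e - d < e - d`.
    directionalDerivative-≮ : ∀ {y d e} →
      DirectionalDerivative R f x y d → DirectionalDerivative R f x y e → ¬ d < e
    directionalDerivative-≮ {y} {d} {e} D E d<e =
      let h , 0<h , h+h≈e-d = half (x<y⇒0<y-x d<e)
          u , (u-d<h , _) , (_ , e-u<h) = common-approximation D E 0<h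
      in <ₚ.irrefl (≈-trans (telescope u) (≈-sym h+h≈e-d)) (+-mono-< u-d<h e-u<h)
      where
      telescope : ∀ u → (u - d) + (e - u) ≈ e - d
      telescope u = begin
        (u + - d) + (e + - u)
          ≈⟨ solve 4 (λ u u′ e d′ → (u :+ d′) :+ (e :+ u′) := (u :+ u′) :+ (e :+ d′))
             ≈-refl u (- u) e (- d) ⟩
        (u - u) + (e - d)
          ≈⟨ ≈-trans (+-congʳ (-‿inverseʳ u)) (+-identityˡ (e - d)) ⟩
        e - d ∎

    -- Tightness of `_#_` reduces equality to the exclusion of both strict orders.
    directionalDerivative-unique : ∀ {y d e} →
      DirectionalDerivative R f x y d → DirectionalDerivative R f x y e → d ≈ e
    directionalDerivative-unique {d = d} {e} D E = proj₁ (tight d e) λ d#e →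
      [ directionalDerivative-≮ D E , directionalDerivative-≮ E D ]′ (Equivalence.to #⇔<⊎> d#e)

    gradient⇒partialDerivative : ∀ {g} → HasGradient f x g → ∀ j → PartialDerivative R f x j (g j)
    gradient⇒partialDerivative {g} hf j =
      directionalDerivative-resp (⟨⟩-unitVectorˡ j g) (gradient⇒directionalDerivative hf (unitVector R j))

    vanishing⇒gradient-constant : ∀ {g} → HasGradient f x g →
      (∀ y → ∑ y ≈ 0# → DirectionalDerivative R f x y 0#) → ∀ i j → g i ≈ g j
    vanishing⇒gradient-constant {g} hf critical i j = begin
      g i                       ≈⟨ +-identityʳ (g i) ⟨
      g i + 0#                  ≈⟨ +-congˡ (≈-trans (*-congʳ (-‿inverseˡ 1#)) (zeroˡ (g j))) ⟨
      g i + (- 1# + 1#) * g j   ≈⟨ solve 3 (λ a b c → a :+ (c :+ con 1) :* b := (a :+ c :* b) :+ b)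
                                     ≈-refl (g i) (g j) (- 1#) ⟩
      (g i + - 1# * g j) + g j  ≈⟨ +-congʳ (⟨eᵢ-eⱼ,⟩ g) ⟨
      ⟨ eᵢ-eⱼ , g ⟩ + g j       ≈⟨ +-congʳ (directionalDerivative-unique
                                     (gradient⇒directionalDerivative hf eᵢ-eⱼ)
                                     (critical eᵢ-eⱼ ∑[eᵢ-eⱼ]≈0)) ⟩
      0# + g j                  ≈⟨ +-identityˡ (g j) ⟩
      g j                       ∎
      where
      eᵢ-eⱼ : Vector Carrier m
      eᵢ-eⱼ k = unitVector R i k + - 1# * unitVector R j k

      ⟨eᵢ-eⱼ,⟩ : ∀ g → ⟨ eᵢ-eⱼ , g ⟩ ≈ g i + - 1# * g j
      ⟨eᵢ-eⱼ,⟩ g = begin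
        ⟨ eᵢ-eⱼ , g ⟩
          ≈⟨ ⟨⟩-comm eᵢ-eⱼ g ⟩
        ⟨ g , eᵢ-eⱼ ⟩
          ≈⟨ ⟨⟩-+ʳ g (unitVector R i) (λ k → - 1# * unitVector R j k) ⟩
        ⟨ g , unitVector R i ⟩ + ⟨ g , (λ k → - 1# * unitVector R j k) ⟩
          ≈⟨ +-cong (⟨⟩-unitVectorʳ g i)
               (≈-trans (⟨⟩-*ʳ (- 1#) g (unitVector R j)) (*-congˡ (⟨⟩-unitVectorʳ g j))) ⟩
        g i + - 1# * g j ∎

      ∑[eᵢ-eⱼ]≈0 : ∑ eᵢ-eⱼ ≈ 0#
      ∑[eᵢ-eⱼ]≈0 = begin
        -- The sum is the pairing with the constant vector `1#`, to which the preceding formula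
        -- applies.
        ∑ eᵢ-eⱼ                 ≈⟨ sum-cong-≋ (λ k → ≈-sym (*-identityʳ (eᵢ-eⱼ k))) ⟩
        ⟨ eᵢ-eⱼ , (λ _ → 1#) ⟩  ≈⟨ ⟨eᵢ-eⱼ,⟩ (λ _ → 1#) ⟩
        1# + - 1# * 1#          ≈⟨ +-congˡ (*-identityʳ (- 1#)) ⟩
        1# - 1#                 ≈⟨ -‿inverseʳ 1# ⟩
        0#                      ∎

  -- Critical points and equal resistances

  common-value : (g : Vector Carrier m) → (∀ i j → g i ≈ g j) → ∃[ a ] (∀ j → a ≈ g j)
  -- Without edges the condition is vacuous, and `0#` is an arbitrary choice.
  common-value {zero}  g g-constant = 0# , λ ()
  common-value {suc m} g g-constant = g zero , g-constant zero

  /-cancel : (b#0 : b # 0#) → x ≈ a /⟨ b#0 ⟩ → b * x ≈ a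
  /-cancel {b} {x} {a} b#0 x≈a/b = begin
    b * x         ≈⟨ *-congˡ x≈a/b ⟩
    b * (a * b⁻¹) ≈⟨ solve 3 (λ a b b⁻¹ → b :* (a :* b⁻¹) := a :* (b :* b⁻¹)) ≈-refl a b b⁻¹ ⟩
    a * (b * b⁻¹) ≈⟨ *-congˡ (/-inverse b#0) ⟩
    a * 1#        ≈⟨ *-identityʳ a ⟩
    a             ∎
    where
    b⁻¹ : Carrier
    b⁻¹ = proj₁ (#⇒invertible b#0)

  module _ {n} (G : Graph n m) (x : Vector Carrier m) (τ#0 : treeNumber R G x # 0#) where
    private
      τ : Carrier
      τ = treeNumber R G x

      ∇τ : Vector Carrier m
      ∇τ = proj₁ (differentiable-treeNumber x G)

      hasGradient : HasGradient (treeNumber R G) x ∇τ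
      hasGradient = proj₂ (differentiable-treeNumber x G)

    critical⇒equalResistances : CriticalPoint R G x →
      ∃[ r ] (∀ j → EffectiveResistance R G x τ#0 j r)
    critical⇒equalResistances critical =
      let a , a≈∇τ = common-value ∇τ
            (vanishing⇒gradient-constant (treeNumber R G) x hasGradient critical)
      -- The common resistance is the common partial derivative divided by the tree number.
      in a /⟨ τ#0 ⟩ , λ j →
         ∇τ j , gradient⇒partialDerivative (treeNumber R G) x hasGradient j , *-congʳ (a≈∇τ j)

    equalResistances⇒critical : ∃[ r ] (∀ j → EffectiveResistance R G x τ#0 j r) →
      CriticalPoint R G x
    equalResistances⇒critical (r , resistance) y ∑y≈0 =
      directionalDerivative-resp (treeNumber R G) x ⟨y,∇τ⟩≈0
        (gradient⇒directionalDerivative (treeNumber R G) x hasGradient y)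
      where
      ∇τ≈τr : ∀ j → ∇τ j ≈ τ * r
      ∇τ≈τr j =
        -- The hypothesis brings its own partial derivative `τⱼ`; uniqueness identifies it with
        -- `∇τ j`.
        let τⱼ , partial , r≈τⱼ/τ = resistance j
        in ≈-trans
             (directionalDerivative-unique (treeNumber R G) x
               (gradient⇒partialDerivative (treeNumber R G) x hasGradient j) partial)
             (≈-sym (/-cancel τ#0 r≈τⱼ/τ))

      ⟨y,∇τ⟩≈0 : ⟨ y , ∇τ ⟩ ≈ 0#
      ⟨y,∇τ⟩≈0 = ≈-trans (sum-cong-≋ (λ j → *-congˡ (∇τ≈τr j))) (⟨⟩-constʳ y ∑y≈0)

proposition2p3 : ∀ {c ℓ₁ ℓ₂ ℓ₃} (R : RealField c ℓ₁ ℓ₂ ℓ₃) {n m : ℕ} (G : Graph n m) →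
    IsConnected G → (x : Vector (RealField.Carrier R) m) →
    InWeightedEdgePolytope R x →
    (τ≠0 : RealField._#_ R (treeNumber R G x) (RealField.0# R)) →
    CriticalPoint R G x ⇔ ∃ (λ r → ∀ j → EffectiveResistance R G x τ≠0 j r)
proposition2p3 R G _ x _ τ≠0 =
  mk⇔ (critical⇒equalResistances R G x τ≠0) (equalResistances⇒critical R G x τ≠0)
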